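{- For all non-negative integers $m$ and $n$, $$\sum_{k=1}^nH_k\sum_{j=m}^k\binom{k-1}{j-1}\frac{s(j,m)}{j!}=\frac{1}{m!}H_n(m)H_n-\frac{1}{m!}\sum_{k=1}^n\frac{H_{k-1}(m)}{k}.$$
   Context: For integers $m\ge 1$, $n\ge 0$, the multiple harmonic-like numbers are $H_n(m)=\sum_{1\le k_1+k_2+\cdots+k_m\le n}\frac{1}{k_1k_2\cdots k_m}$ (sum over positive integers $k_1,\dots,k_m$), with $H_n(0)=1$ for $n\ge 0$ and $H_0(m)=0$ for $m\ge1$. $H_n=H_n(1)=\sum_{k=1}^n\frac1k$. The (signed) Stirling numbers of the first kind $s(n,k)$ are defined by $\sum_{n\ge k}s(n,k)\frac{z^n}{n!}=\frac{\ln^k(1+z)}{k!}$, with $s(n,k)=0$ for $n<k$. Binomial coefficients with negative lower index are $0$. -}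

module Defs where

open import Data.Nat as ℕ using (ℕ; zero; suc; _∸_; _!)
open import Data.Nat.Combinatorics using (_C_)
open import Data.Integer as ℤ using (ℤ; +_; -[1+_]; -1ℤ)
open import Data.Rational using (ℚ; 0ℚ; 1ℚ; _+_; _*_; _/_)
open import Data.List using (List; []; _∷_; foldr; map; filter; applyUpTo; cartesianProductWith)
open import Data.Vec as Vec using (Vec)
open import Relation.Nullary.Decidable using (_×-dec_)

-- 1/n.  The value at 0 is a dummy: every use below and in the theorem has n ≥ 1.
recip : ℕ → ℚ
recip zero      = 0ℚ
recip n@(suc _) = + 1 / n

fromℕ : ℕ → ℚ
fromℕ n = + n / 1

-- The integers a, a+1, …, b (none if b < a).
[_⋯_] : ℕ → ℕ → List ℕ
[ a ⋯ b ] = applyUpTo (a ℕ.+_) (suc b ∸ a)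

sumOver : ∀ {A : Set} → List A → (A → ℚ) → ℚ
sumOver xs f = foldr _+_ 0ℚ (map f xs)

syntax sumOver xs (λ x → e) = ∑[ x ∈ xs ] e
infix 5 sumOver

binom : ℕ → ℤ → ℕ
binom n (+ k)    = n C k
binom n -[1+ _ ] = 0

-- All (k₁, …, k_m) with 1 ≤ kᵢ ≤ n.
tuples : (m n : ℕ) → List (Vec ℕ m)
tuples zero    n = Vec.[] ∷ []
tuples (suc m) n = cartesianProductWith Vec._∷_ [ 1 ⋯ n ] (tuples m n)

-- The positive m-tuples with 1 ≤ k₁ + ⋯ + k_m ≤ n; the second bound forces
-- each kᵢ ≤ n, so filtering `tuples m n` loses none of them.
boundedTuples : (m n : ℕ) → List (Vec ℕ m)
boundedTuples m n =
  filter (λ k → (1 ℕ.≤? Vec.sum k) ×-dec (Vec.sum k ℕ.≤? n)) (tuples m n)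

-- multiH n m is H_n(m).
multiH : (n m : ℕ) → ℚ
multiH n zero      = 1ℚ
multiH n m@(suc _) = ∑[ k ∈ boundedTuples m n ] recip (Vec.foldr′ ℕ._*_ 1 k)

H : ℕ → ℚ
H n = ∑[ k ∈ [ 1 ⋯ n ] ] recip k

-- Formal power series over ℚ, as coefficient sequences.
Series : Set
Series = ℕ → ℚ

one : Series
one zero    = 1ℚ
one (suc _) = 0ℚ

_⊛_ : Series → Series → Series
(f ⊛ g) n = ∑[ i ∈ [ 0 ⋯ n ] ] f i * g (n ∸ i)

_^ˢ_ : Series → ℕ → Series
f ^ˢ zero  = one
f ^ˢ suc k = f ⊛ (f ^ˢ k)

-- ln(1+z) = Σ_{n≥1} (-1)ⁿ⁻¹ zⁿ/n
ln1+z : Series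
ln1+z zero    = 0ℚ
ln1+z (suc n) = (-1ℤ ℤ.^ n) / suc n

-- Signed Stirling numbers of the first kind, read off from
-- Σ_n s(n,k) zⁿ/n! = ln(1+z)ᵏ/k!.  They vanish for n < k since ln(1+z) has
-- no constant term.
s : (n k : ℕ) → ℚ
s n k = fromℕ (n !) * (recip (k !) * (ln1+z ^ˢ k) n)

{-# OPTIONS --safe #-}

-- The binomial transform 𝓑 f n = Σᵢ C(n,i) fᵢ has generating function
-- f(z/(1-z))/(1-z), so it takes ln(1+z)ᵐ to (-ln(1-z))ᵐ/(1-z), whose
-- coefficients are the H_n(m).  Pascal's rule then turns the inner sum of the
-- theorem into (H_k(m) - H_{k-1}(m))/m!, and summation by parts finishes.

module Submission where

open import Defs
open import Data.Nat using (ℕ; _∸_; _!)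
open import Data.Integer using (_⊖_)
open import Data.Rational using (_*_; _-_)
open import Relation.Binary.PropositionalEquality using (_≡_)

open import Data.Bool using (true; false; if_then_else_)
open import Data.Integer as ℤ using (-1ℤ)
import Data.Integer.Properties as ℤ
open import Data.List using (List; []; _∷_; _++_; map; filter; applyUpTo; cartesianProductWith)
open import Data.Nat as ℕ using (zero; suc; _≤_; _<_; z≤n; s≤s; NonZero)
open import Data.Nat.Combinatorics using (_C_; nCk+nC[k+1]≡[n+1]C[k+1])
import Data.Nat.Properties as ℕ
open import Data.Rational using (ℚ; 0ℚ; 1ℚ; _+_; -_; _/_; fromℚᵘ)
open import Data.Rational.Properties
open import Data.Rational.Solver using (module +-*-Solver)
open import Data.Rational.Unnormalised as ℚᵘ using (mkℚᵘ; *≡*)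
import Data.Rational.Unnormalised.Properties as ℚᵘ
open import Data.Vec as Vec using (Vec)
open import Function using (_∘_; id)
open import Relation.Binary.PropositionalEquality using (refl; sym; trans; cong; cong₂; _≗_; module ≡-Reasoning)
open import Relation.Nullary using (does)
open import Relation.Unary using (Decidable)

open +-*-Solver using (solve; _:=_; _:+_; _:*_; _:-_)
open ≡-Reasoning

-- Rational arithmetic

-- `z / suc n` is by definition `fromℚᵘ (mkℚᵘ z n)`, so identities between fractions can be checked
-- on unnormalised ones, where no gcd has to be cancelled.
fromℚᵘ-homo-+ : ∀ p q → fromℚᵘ (p ℚᵘ.+ q) ≡ fromℚᵘ p + fromℚᵘ q
fromℚᵘ-homo-+ p q = toℚᵘ-injective (ℚᵘ.≃-trans (toℚᵘ-fromℚᵘ (p ℚᵘ.+ q)) (ℚᵘ.≃-sym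
  (ℚᵘ.≃-trans (toℚᵘ-homo-+ (fromℚᵘ p) (fromℚᵘ q)) (ℚᵘ.+-cong (toℚᵘ-fromℚᵘ p) (toℚᵘ-fromℚᵘ q)))))

fromℚᵘ-homo-* : ∀ p q → fromℚᵘ (p ℚᵘ.* q) ≡ fromℚᵘ p * fromℚᵘ q
fromℚᵘ-homo-* p q = toℚᵘ-injective (ℚᵘ.≃-trans (toℚᵘ-fromℚᵘ (p ℚᵘ.* q)) (ℚᵘ.≃-sym
  (ℚᵘ.≃-trans (toℚᵘ-homo-* (fromℚᵘ p) (fromℚᵘ q)) (ℚᵘ.*-cong (toℚᵘ-fromℚᵘ p) (toℚᵘ-fromℚᵘ q)))))

fromℕ-+ : ∀ a b → fromℕ (a ℕ.+ b) ≡ fromℕ a + fromℕ b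
fromℕ-+ a b = trans
  (fromℚᵘ-cong {mkℚᵘ (ℤ.+ (a ℕ.+ b)) 0} {mkℚᵘ (ℤ.+ a) 0 ℚᵘ.+ mkℚᵘ (ℤ.+ b) 0}
    (*≡* (cong (ℤ._* ℤ.+ 1) (sym (cong₂ ℤ._+_ (ℤ.*-identityʳ (ℤ.+ a)) (ℤ.*-identityʳ (ℤ.+ b)))))))
  (fromℚᵘ-homo-+ (mkℚᵘ (ℤ.+ a) 0) (mkℚᵘ (ℤ.+ b) 0))

n*[z/n]≡z : ∀ n z → fromℕ (suc n) * (z / suc n) ≡ z / 1
n*[z/n]≡z n z = trans
  (sym (fromℚᵘ-homo-* (mkℚᵘ (ℤ.+ suc n) 0) (mkℚᵘ z n)))
  (fromℚᵘ-cong {mkℚᵘ (ℤ.+ suc n) 0 ℚᵘ.* mkℚᵘ z n} {mkℚᵘ z 0} (*≡* (begin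
    (ℤ.+ suc n ℤ.* z) ℤ.* ℤ.+ 1       ≡⟨ ℤ.*-identityʳ _ ⟩
    ℤ.+ suc n ℤ.* z                 ≡⟨ ℤ.*-comm (ℤ.+ suc n) z ⟩
    z ℤ.* ℤ.+ suc n                 ≡⟨ cong (λ d → z ℤ.* ℤ.+ d) (sym (ℕ.*-identityˡ (suc n))) ⟩
    z ℤ.* ℤ.+ (1 ℕ.* suc n)         ∎)))

n*recip[n]≡1 : ∀ n .{{_ : NonZero n}} → fromℕ n * recip n ≡ 1ℚ
n*recip[n]≡1 (suc n) = n*[z/n]≡z n (ℤ.+ 1)

-- The dummy value 0 at 0 is compatible with products, so the summand of a tuple factors entry by
-- entry.
recip-* : ∀ a b → recip (a ℕ.* b) ≡ recip a * recip b
recip-* zero    b       = sym (*-zeroˡ (recip b))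
recip-* (suc a) zero    = trans (cong recip (ℕ.*-zeroʳ a)) (sym (*-zeroʳ (recip (suc a))))
recip-* (suc a) (suc b) = fromℚᵘ-homo-* (mkℚᵘ (ℤ.+ 1) a) (mkℚᵘ (ℤ.+ 1) b)

*-cancelˡ-suc : ∀ n {p q} → fromℕ (suc n) * p ≡ fromℕ (suc n) * q → p ≡ q
*-cancelˡ-suc n {p} {q} eq = begin
  p                                     ≡⟨ inv p ⟩
  recip (suc n) * (fromℕ (suc n) * p)   ≡⟨ cong (recip (suc n) *_) eq ⟩
  recip (suc n) * (fromℕ (suc n) * q)   ≡⟨ inv q ⟨
  q                                     ∎
  where
  inv : ∀ x → x ≡ recip (suc n) * (fromℕ (suc n) * x)
  inv x = begin
    x                                     ≡⟨ *-identityˡ x ⟨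
    1ℚ * x                                ≡⟨ cong (_* x) (n*recip[n]≡1 (suc n)) ⟨
    fromℕ (suc n) * recip (suc n) * x     ≡⟨ solve 3 (λ a b c → a :* b :* c := b :* (a :* c)) refl (fromℕ (suc n)) (recip (suc n)) x ⟩
    recip (suc n) * (fromℕ (suc n) * x)   ∎

-- Finite sums

-- Common form for all sums over ranges. Peeling from the front turns the inductive step into the
-- shift `f ∘ suc`, as in the recursion of `𝓑`.
sumTo : ℕ → (ℕ → ℚ) → ℚ
sumTo zero    f = 0ℚ
sumTo (suc n) f = f 0 + sumTo n (f ∘ suc)

sumOver-applyUpTo : ∀ {A : Set} (g : ℕ → A) f n → sumOver (applyUpTo g n) f ≡ sumTo n (f ∘ g)
sumOver-applyUpTo g f zero    = refl
sumOver-applyUpTo g f (suc n) = cong (f (g 0) +_) (sumOver-applyUpTo (g ∘ suc) f n)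

sumTo-zero : ∀ n {f} → (∀ i → i < n → f i ≡ 0ℚ) → sumTo n f ≡ 0ℚ
sumTo-zero zero    f≡0 = refl
sumTo-zero (suc n) f≡0 = cong₂ _+_ (f≡0 0 (s≤s z≤n)) (sumTo-zero n (λ i i<n → f≡0 (suc i) (s≤s i<n)))

sumTo-restrict : ∀ {n N f g} → n ≤ N → (∀ i → i < n → f i ≡ g i) → (∀ i → n ≤ i → f i ≡ 0ℚ) →
                 sumTo N f ≡ sumTo n g
sumTo-restrict {N = N} z≤n _ f≡0 = sumTo-zero N (λ i _ → f≡0 i z≤n)
sumTo-restrict (s≤s n≤N) f≡g f≡0 = cong₂ _+_ (f≡g 0 (s≤s z≤n))
  (sumTo-restrict n≤N (λ i i<n → f≡g (suc i) (s≤s i<n)) (λ i n≤i → f≡0 (suc i) (s≤s n≤i)))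

sumTo-cong : ∀ n {f g} → f ≗ g → sumTo n f ≡ sumTo n g
sumTo-cong zero    f≗g = refl
sumTo-cong (suc n) f≗g = cong₂ _+_ (f≗g 0) (sumTo-cong n (f≗g ∘ suc))

sumTo-+ : ∀ n f g → sumTo n (λ i → f i + g i) ≡ sumTo n f + sumTo n g
sumTo-+ zero    f g = refl
sumTo-+ (suc n) f g = trans (cong (f 0 + g 0 +_) (sumTo-+ n (f ∘ suc) (g ∘ suc)))
  (solve 4 (λ a b c d → (a :+ b) :+ (c :+ d) := (a :+ c) :+ (b :+ d)) refl
    (f 0) (g 0) (sumTo n (f ∘ suc)) (sumTo n (g ∘ suc)))

sumTo-*ˡ : ∀ n c f → sumTo n (λ i → c * f i) ≡ c * sumTo n f
sumTo-*ˡ zero    c f = sym (*-zeroʳ c)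
sumTo-*ˡ (suc n) c f = trans (cong (c * f 0 +_) (sumTo-*ˡ n c (f ∘ suc))) (sym (*-distribˡ-+ c (f 0) (sumTo n (f ∘ suc))))

sumTo-last : ∀ n f → sumTo (suc n) f ≡ sumTo n f + f n
sumTo-last zero    f = +-comm (f 0) 0ℚ
sumTo-last (suc n) f = trans (cong (f 0 +_) (sumTo-last n (f ∘ suc))) (sym (+-assoc (f 0) (sumTo n (f ∘ suc)) (f (suc n))))

-- Frees the inner sum of its lower limit. If `a` exceeds `n`, the left side is empty and the right
-- side has only zero terms.
sumTo-drop : ∀ a n f → (∀ i → i < a → f i ≡ 0ℚ) → sumTo (n ∸ a) (f ∘ (a ℕ.+_)) ≡ sumTo n f
sumTo-drop zero    n       f f≡0 = refl
sumTo-drop (suc a) zero    f f≡0 = refl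
sumTo-drop (suc a) (suc n) f f≡0 = begin
  sumTo (n ∸ a) (f ∘ suc ∘ (a ℕ.+_))   ≡⟨ sumTo-drop a n (f ∘ suc) (λ i i<a → f≡0 (suc i) (s≤s i<a)) ⟩
  sumTo n (f ∘ suc)                    ≡⟨ +-identityˡ _ ⟨
  0ℚ + sumTo n (f ∘ suc)               ≡⟨ cong (_+ sumTo n (f ∘ suc)) (f≡0 0 (s≤s z≤n)) ⟨
  sumTo (suc n) f                      ∎

sumOver-cong : ∀ {A : Set} (xs : List A) {f g : A → ℚ} → f ≗ g → sumOver xs f ≡ sumOver xs g
sumOver-cong []       f≗g = refl
sumOver-cong (x ∷ xs) f≗g = cong₂ _+_ (f≗g x) (sumOver-cong xs f≗g)

sumOver-*ˡ : ∀ {A : Set} (xs : List A) c (f : A → ℚ) → sumOver xs (λ x → c * f x) ≡ c * sumOver xs f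
sumOver-*ˡ []       c f = sym (*-zeroʳ c)
sumOver-*ˡ (x ∷ xs) c f = trans (cong (c * f x +_) (sumOver-*ˡ xs c f)) (sym (*-distribˡ-+ c (f x) (sumOver xs f)))

sumOver-zero : ∀ {A : Set} (xs : List A) {f : A → ℚ} → (∀ x → f x ≡ 0ℚ) → sumOver xs f ≡ 0ℚ
sumOver-zero []       f≡0 = refl
sumOver-zero (x ∷ xs) f≡0 = cong₂ _+_ (f≡0 x) (sumOver-zero xs f≡0)

sumOver-map-++ : ∀ {A B : Set} (g : A → B) xs ys (f : B → ℚ) →
                 sumOver (map g xs ++ ys) f ≡ sumOver xs (f ∘ g) + sumOver ys f
sumOver-map-++ g []       ys f = sym (+-identityˡ _)
sumOver-map-++ g (x ∷ xs) ys f = trans (cong (f (g x) +_) (sumOver-map-++ g xs ys f)) (sym (+-assoc (f (g x)) (sumOver xs (f ∘ g)) (sumOver ys f)))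

sumOver-cartesianProductWith : ∀ {A B D : Set} (g : A → B → D) xs ys (f : D → ℚ) →
  sumOver (cartesianProductWith g xs ys) f ≡ sumOver xs (λ x → sumOver ys (λ y → f (g x y)))
sumOver-cartesianProductWith g []       ys f = refl
sumOver-cartesianProductWith g (x ∷ xs) ys f = trans
  (sumOver-map-++ (g x) ys (cartesianProductWith g xs ys) f)
  (cong (sumOver ys (f ∘ g x) +_) (sumOver-cartesianProductWith g xs ys f))

sumOver-filter : ∀ {A : Set} {P : A → Set} (P? : Decidable P) xs (f : A → ℚ) →
  sumOver (filter P? xs) f ≡ sumOver xs (λ x → if does (P? x) then f x else 0ℚ)
sumOver-filter P? []       f = refl
sumOver-filter P? (x ∷ xs) f with does (P? x)
... | true  = cong (f x +_) (sumOver-filter P? xs f)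
... | false = trans (sumOver-filter P? xs f) (sym (+-identityˡ _))

-- Products of series

⊛-sumTo : ∀ f g n → (f ⊛ g) n ≡ sumTo (suc n) (λ i → f i * g (n ∸ i))
⊛-sumTo f g n = sumOver-applyUpTo id (λ i → f i * g (n ∸ i)) (suc n)

-- Writing f = f(0) + z f₁ with f₁ = `f ∘ suc`, the shift of f g is f(0) times the shift of g, plus
-- f₁ g.
⊛-suc : ∀ f g n → (f ⊛ g) (suc n) ≡ f 0 * g (suc n) + ((f ∘ suc) ⊛ g) n
⊛-suc f g n = trans (⊛-sumTo f g (suc n)) (cong (f 0 * g (suc n) +_) (sym (⊛-sumTo (f ∘ suc) g n)))

⊛-congʳ : ∀ {f f′} g → f ≗ f′ → (f ⊛ g) ≗ (f′ ⊛ g)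
⊛-congʳ g f≗f′ n = sumOver-cong [ 0 ⋯ n ] (λ i → cong (_* g (n ∸ i)) (f≗f′ i))

⊛-distribʳ-+ : ∀ f f′ g n → ((λ i → f i + f′ i) ⊛ g) n ≡ (f ⊛ g) n + (f′ ⊛ g) n
⊛-distribʳ-+ f f′ g n = begin
  ((λ i → f i + f′ i) ⊛ g) n                                 ≡⟨ ⊛-sumTo (λ i → f i + f′ i) g n ⟩
  sumTo (suc n) (λ i → (f i + f′ i) * g (n ∸ i))              ≡⟨ sumTo-cong (suc n) (λ i → *-distribʳ-+ (g (n ∸ i)) (f i) (f′ i)) ⟩
  sumTo (suc n) (λ i → f i * g (n ∸ i) + f′ i * g (n ∸ i))    ≡⟨ sumTo-+ (suc n) (λ i → f i * g (n ∸ i)) (λ i → f′ i * g (n ∸ i)) ⟩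
  _                                                          ≡⟨ cong₂ _+_ (⊛-sumTo f g n) (⊛-sumTo f′ g n) ⟨
  (f ⊛ g) n + (f′ ⊛ g) n                                     ∎

scaledOne-⊛ : ∀ c g n → ((λ i → c * one i) ⊛ g) n ≡ c * g n
scaledOne-⊛ c g n = begin
  ((λ i → c * one i) ⊛ g) n                                       ≡⟨ ⊛-sumTo (λ i → c * one i) g n ⟩
  c * 1ℚ * g n + sumTo n (λ i → c * 0ℚ * g (n ∸ suc i))           ≡⟨ cong₂ _+_ (cong (_* g n) (*-identityʳ c)) (sumTo-zero n vanish) ⟩
  c * g n + 0ℚ                                                    ≡⟨ +-identityʳ _ ⟩
  c * g n                                                         ∎
  where
  vanish : ∀ i → i < n → c * 0ℚ * g (n ∸ suc i) ≡ 0ℚ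
  vanish i _ = trans (cong (_* g (n ∸ suc i)) (*-zeroʳ c)) (*-zeroˡ (g (n ∸ suc i)))

-- The factor ln(1+z) has no constant term, so each multiplication by it raises the order by at
-- least one.
ln^-vanish : ∀ m j → j < m → (ln1+z ^ˢ m) j ≡ 0ℚ
ln^-vanish (suc m) j (s≤s j≤m) = trans (⊛-sumTo ln1+z (ln1+z ^ˢ m) j)
  (cong₂ _+_ (*-zeroˡ ((ln1+z ^ˢ m) j)) (sumTo-zero j vanish))
  where
  vanish : ∀ i → i < j → ln1+z (suc i) * (ln1+z ^ˢ m) (j ∸ suc i) ≡ 0ℚ
  vanish i i<j = trans
    (cong (ln1+z (suc i) *_) (ln^-vanish m (j ∸ suc i) (ℕ.<-≤-trans (ℕ.∸-monoʳ-< (s≤s z≤n) i<j) j≤m)))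
    (*-zeroʳ (ln1+z (suc i)))

-- The binomial transform

-- Encoded by Pascal's rule, so that linearity and the product rule are inductions on n for all
-- series at once; `sumTo-binomial` recovers the explicit sum.
𝓑 : Series → Series
𝓑 f zero    = f 0
𝓑 f (suc n) = 𝓑 f n + 𝓑 (f ∘ suc) n

𝓑-cong : ∀ {f g} → f ≗ g → 𝓑 f ≗ 𝓑 g
𝓑-cong f≗g zero    = f≗g 0
𝓑-cong f≗g (suc n) = cong₂ _+_ (𝓑-cong f≗g n) (𝓑-cong (f≗g ∘ suc) n)

𝓑-+ : ∀ f g n → 𝓑 (λ i → f i + g i) n ≡ 𝓑 f n + 𝓑 g n
𝓑-+ f g zero    = refl
𝓑-+ f g (suc n) = trans (cong₂ _+_ (𝓑-+ f g n) (𝓑-+ (f ∘ suc) (g ∘ suc) n))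
  (solve 4 (λ a b c d → (a :+ b) :+ (c :+ d) := (a :+ c) :+ (b :+ d)) refl
    (𝓑 f n) (𝓑 g n) (𝓑 (f ∘ suc) n) (𝓑 (g ∘ suc) n))

𝓑-*ˡ : ∀ c f n → 𝓑 (λ i → c * f i) n ≡ c * 𝓑 f n
𝓑-*ˡ c f zero    = refl
𝓑-*ˡ c f (suc n) = trans (cong₂ _+_ (𝓑-*ˡ c f n) (𝓑-*ˡ c (f ∘ suc) n)) (sym (*-distribˡ-+ c (𝓑 f n) (𝓑 (f ∘ suc) n)))

-- Terms beyond k vanish, so any length N > k will do. The induction uses this freedom: Pascal's
-- rule produces row k once with length N + 1 and once with length N.
sumTo-binomial : ∀ k N f → k < N → sumTo N (λ i → fromℕ (k C i) * f i) ≡ 𝓑 f k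
sumTo-binomial zero (suc N) f _ = begin
  1ℚ * f 0 + sumTo N (λ i → 0ℚ * f (suc i))   ≡⟨ cong₂ _+_ (*-identityˡ (f 0)) (sumTo-zero N (λ i _ → *-zeroˡ (f (suc i)))) ⟩
  f 0 + 0ℚ                                    ≡⟨ +-identityʳ (f 0) ⟩
  f 0                                         ∎
sumTo-binomial (suc k) (suc N) f (s≤s k<N) = begin
  x + sumTo N (λ i → fromℕ (suc k C suc i) * f (suc i))   ≡⟨ cong (x +_) (sumTo-cong N pascal) ⟩
  x + sumTo N (λ i → a i + b i)                           ≡⟨ cong (x +_) (sumTo-+ N a b) ⟩
  x + (sumTo N a + sumTo N b)                             ≡⟨ solve 3 (λ x a b → x :+ (a :+ b) := (x :+ b) :+ a) refl x (sumTo N a) (sumTo N b) ⟩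
  -- Since C(k,0) = 1, `x` is the missing initial term of the sum of `b`.
  (x + sumTo N b) + sumTo N a                             ≡⟨ cong₂ _+_ (sumTo-binomial k (suc N) f (ℕ.m<n⇒m<1+n k<N)) (sumTo-binomial k N (f ∘ suc) k<N) ⟩
  𝓑 f k + 𝓑 (f ∘ suc) k                                   ∎
  where
  x = 1ℚ * f 0
  a b : ℕ → ℚ
  a i = fromℕ (k C i) * f (suc i)
  b i = fromℕ (k C suc i) * f (suc i)
  pascal : ∀ i → fromℕ (suc k C suc i) * f (suc i) ≡ a i + b i
  pascal i = begin
    fromℕ (suc k C suc i) * f (suc i)                 ≡⟨ cong (λ c → fromℕ c * f (suc i)) (nCk+nC[k+1]≡[n+1]C[k+1] k i) ⟨
    fromℕ (k C i ℕ.+ k C suc i) * f (suc i)           ≡⟨ cong (_* f (suc i)) (fromℕ-+ (k C i) (k C suc i)) ⟩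
    (fromℕ (k C i) + fromℕ (k C suc i)) * f (suc i)   ≡⟨ *-distribʳ-+ (f (suc i)) (fromℕ (k C i)) (fromℕ (k C suc i)) ⟩
    a i + b i                                         ∎

-- The composition f(z/(1-z)).
𝓣 : Series → Series
𝓣 f zero    = f 0
𝓣 f (suc n) = 𝓑 (f ∘ suc) n

-- Put w = z/(1-z), so that 1/(1-z) = 1 + w. With f = f(0) + z f₁, both sides are the coefficients
-- of f(w) + f₁(w).
𝓑-shift : ∀ f n → 𝓑 (f ∘ suc) n + f 0 * one n ≡ 𝓣 f n + 𝓣 (f ∘ suc) n
𝓑-shift f zero    = trans (cong (f 1 +_) (*-identityʳ (f 0))) (+-comm (f 1) (f 0))
𝓑-shift f (suc n) = trans (cong (𝓑 (f ∘ suc) (suc n) +_) (*-zeroʳ (f 0))) (+-identityʳ _)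

-- Substituting z/(1-z) is multiplicative, and the single factor 1/(1-z) is assigned to g.
𝓑-⊛ : ∀ f g n → 𝓑 (f ⊛ g) n ≡ (𝓣 f ⊛ 𝓑 g) n
𝓑-⊛ f g zero    = refl
𝓑-⊛ f g (suc n) = begin
  𝓑 (f ⊛ g) n + 𝓑 ((f ⊛ g) ∘ suc) n                       ≡⟨ cong (𝓑 (f ⊛ g) n +_) tail ⟩
  𝓑 (f ⊛ g) n + (f 0 * 𝓑 (g ∘ suc) n + 𝓑 ((f ∘ suc) ⊛ g) n)  ≡⟨ cong₂ (λ x y → x + (f 0 * 𝓑 (g ∘ suc) n + y)) (𝓑-⊛ f g n) (𝓑-⊛ (f ∘ suc) g n) ⟩
  p + (f 0 * 𝓑 (g ∘ suc) n + q)                           ≡⟨ solve 3 (λ p x q → p :+ (x :+ q) := x :+ (p :+ q)) refl p (f 0 * 𝓑 (g ∘ suc) n) q ⟩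
  f 0 * 𝓑 (g ∘ suc) n + (p + q)                           ≡⟨ cong (f 0 * 𝓑 (g ∘ suc) n +_) combine ⟨
  f 0 * 𝓑 (g ∘ suc) n + (r + f 0 * 𝓑 g n)                 ≡⟨ solve 4 (λ c x r y → c :* x :+ (r :+ c :* y) := c :* (y :+ x) :+ r) refl (f 0) (𝓑 (g ∘ suc) n) r (𝓑 g n) ⟩
  -- The bracket is `𝓑 g (suc n)`, and `𝓑 (f ∘ suc)` inside `r` is the shift of `𝓣 f`, so `⊛-suc`
  -- applies.
  f 0 * (𝓑 g n + 𝓑 (g ∘ suc) n) + r                       ≡⟨ ⊛-suc (𝓣 f) (𝓑 g) n ⟨
  (𝓣 f ⊛ 𝓑 g) (suc n)                                     ∎
  where
  p = (𝓣 f ⊛ 𝓑 g) n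
  q = (𝓣 (f ∘ suc) ⊛ 𝓑 g) n
  r = (𝓑 (f ∘ suc) ⊛ 𝓑 g) n
  tail : 𝓑 ((f ⊛ g) ∘ suc) n ≡ f 0 * 𝓑 (g ∘ suc) n + 𝓑 ((f ∘ suc) ⊛ g) n
  tail = begin
    𝓑 ((f ⊛ g) ∘ suc) n                                     ≡⟨ 𝓑-cong (⊛-suc f g) n ⟩
    𝓑 (λ i → f 0 * g (suc i) + ((f ∘ suc) ⊛ g) i) n           ≡⟨ 𝓑-+ (λ i → f 0 * g (suc i)) ((f ∘ suc) ⊛ g) n ⟩
    𝓑 (λ i → f 0 * g (suc i)) n + 𝓑 ((f ∘ suc) ⊛ g) n         ≡⟨ cong (_+ 𝓑 ((f ∘ suc) ⊛ g) n) (𝓑-*ˡ (f 0) (g ∘ suc) n) ⟩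
    f 0 * 𝓑 (g ∘ suc) n + 𝓑 ((f ∘ suc) ⊛ g) n                 ∎
  -- This is `𝓑-shift` convolved with `𝓑 g`; the constant f(0) enters as a multiple of `one`.
  combine : r + f 0 * 𝓑 g n ≡ p + q
  combine = begin
    r + f 0 * 𝓑 g n                                    ≡⟨ cong (r +_) (scaledOne-⊛ (f 0) (𝓑 g) n) ⟨
    r + ((λ i → f 0 * one i) ⊛ 𝓑 g) n                  ≡⟨ ⊛-distribʳ-+ (𝓑 (f ∘ suc)) (λ i → f 0 * one i) (𝓑 g) n ⟨
    ((λ i → 𝓑 (f ∘ suc) i + f 0 * one i) ⊛ 𝓑 g) n      ≡⟨ ⊛-congʳ (𝓑 g) (𝓑-shift f) n ⟩
    ((λ i → 𝓣 f i + 𝓣 (f ∘ suc) i) ⊛ 𝓑 g) n            ≡⟨ ⊛-distribʳ-+ (𝓣 f) (𝓣 (f ∘ suc)) (𝓑 g) n ⟩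
    p + q                                              ∎

-- The Euler operator z d/dz and the image of the logarithm

θ : Series → Series
θ f n = fromℕ n * f n

θ-suc : ∀ f n → θ f (suc n) ≡ θ (f ∘ suc) n + f (suc n)
θ-suc f n = begin
  fromℕ (1 ℕ.+ n) * f (suc n)     ≡⟨ cong (_* f (suc n)) (fromℕ-+ 1 n) ⟩
  (1ℚ + fromℕ n) * f (suc n)      ≡⟨ *-distribʳ-+ (f (suc n)) 1ℚ (fromℕ n) ⟩
  1ℚ * f (suc n) + θ (f ∘ suc) n  ≡⟨ cong (_+ θ (f ∘ suc) n) (*-identityˡ (f (suc n))) ⟩
  f (suc n) + θ (f ∘ suc) n       ≡⟨ +-comm (f (suc n)) (θ (f ∘ suc) n) ⟩
  θ (f ∘ suc) n + f (suc n)       ∎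

-- Absorption: i C(n,i) = n C(n-1,i-1).
𝓑-θ : ∀ f n → 𝓑 (θ f) n ≡ θ (𝓣 f) n
𝓑-θ f zero    = refl
𝓑-θ f (suc n) = begin
  𝓑 (θ f) n + 𝓑 (θ f ∘ suc) n                            ≡⟨ cong (𝓑 (θ f) n +_) (𝓑-cong (θ-suc f) n) ⟩
  𝓑 (θ f) n + 𝓑 (λ i → θ (f ∘ suc) i + f (suc i)) n      ≡⟨ cong (𝓑 (θ f) n +_) (𝓑-+ (θ (f ∘ suc)) (f ∘ suc) n) ⟩
  𝓑 (θ f) n + (𝓑 (θ (f ∘ suc)) n + b)                    ≡⟨ cong₂ (λ x y → x + (y + b)) (𝓑-θ f n) (𝓑-θ (f ∘ suc) n) ⟩
  c * 𝓣 f n + (c * 𝓣 (f ∘ suc) n + b)                    ≡⟨ solve 4 (λ c x y b → c :* x :+ (c :* y :+ b) := c :* (x :+ y) :+ b) refl c (𝓣 f n) (𝓣 (f ∘ suc) n) b ⟩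
  c * (𝓣 f n + 𝓣 (f ∘ suc) n) + b                        ≡⟨ cong (λ x → c * x + b) (𝓑-shift f n) ⟨
  c * (b + f 0 * one n) + b                              ≡⟨ cong (_+ b) (drop n) ⟩
  c * b + b                                              ≡⟨ θ-suc (𝓣 f) n ⟨
  θ (𝓣 f) (suc n)                                        ∎
  where
  b = 𝓑 (f ∘ suc) n
  c = fromℕ n
  -- The correction f(0) is present only at k = 0, where the factor k kills it.
  drop : ∀ k → fromℕ k * (b + f 0 * one k) ≡ fromℕ k * b
  drop zero    = trans (*-zeroˡ (b + f 0 * 1ℚ)) (sym (*-zeroˡ b))
  drop (suc k) = cong (fromℕ (suc k) *_) (trans (cong (b +_) (*-zeroʳ (f 0))) (+-identityʳ b))

alternating : Series
alternating n = (-1ℤ ℤ.^ n) / 1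

alternating-suc : ∀ n → alternating (suc n) ≡ (- 1ℚ) * alternating n
alternating-suc n = fromℚᵘ-homo-* (mkℚᵘ -1ℤ 0) (mkℚᵘ (-1ℤ ℤ.^ n) 0)

-- The series is 1/(1+z). At w = z/(1-z) it becomes 1-z, which cancels the factor 1/(1-z) and leaves
-- the constant 1.
𝓑-alternating : ∀ n → 𝓑 alternating (suc n) ≡ 0ℚ
𝓑-alternating n = begin
  x + 𝓑 (alternating ∘ suc) n              ≡⟨ cong (x +_) (𝓑-cong alternating-suc n) ⟩
  x + 𝓑 (λ i → (- 1ℚ) * alternating i) n   ≡⟨ cong (x +_) (𝓑-*ˡ (- 1ℚ) alternating n) ⟩
  x + (- 1ℚ) * x                ≡⟨ cong (_+ (- 1ℚ) * x) (*-identityˡ x) ⟨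
  1ℚ * x + (- 1ℚ) * x           ≡⟨ *-distribʳ-+ x 1ℚ (- 1ℚ) ⟨
  0ℚ * x                        ≡⟨ *-zeroˡ x ⟩
  0ℚ                            ∎
  where x = 𝓑 alternating n

-- Here z d/dz ln(1+z) = z/(1+z), which the transform sends to z/(1-z).
𝓑-θln : ∀ n → 𝓑 (θ ln1+z) (suc n) ≡ 1ℚ
𝓑-θln n = trans (cong (𝓑 (θ ln1+z) n +_) (𝓑-cong θln-suc n)) (go n)
  where
  θln-suc : ∀ i → θ ln1+z (suc i) ≡ alternating i
  θln-suc i = n*[z/n]≡z i (-1ℤ ℤ.^ i)
  -- The alternating part contributes 1 at k = 0 and nothing later, so the value 1 is carried along.
  go : ∀ k → 𝓑 (θ ln1+z) k + 𝓑 alternating k ≡ 1ℚ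
  go zero    = refl
  go (suc k) = cong₂ _+_ (𝓑-θln k) (𝓑-alternating k)

-- ln(1 + z/(1-z)) = -ln(1-z)
𝓣-ln : 𝓣 ln1+z ≗ recip
𝓣-ln zero    = refl
-- Multiplying by n + 1 applies z d/dz, which replaces the logarithm by a rational function.
𝓣-ln (suc n) = *-cancelˡ-suc n (begin
  θ (𝓣 ln1+z) (suc n)             ≡⟨ 𝓑-θ ln1+z (suc n) ⟨
  𝓑 (θ ln1+z) (suc n)             ≡⟨ 𝓑-θln n ⟩
  1ℚ                              ≡⟨ n*recip[n]≡1 (suc n) ⟨
  fromℕ (suc n) * recip (suc n)   ∎)

𝓑-one : ∀ n → 𝓑 one n ≡ 1ℚ
𝓑-one zero    = refl
𝓑-one (suc n) = cong₂ _+_ (𝓑-one n) (𝓑-zero n)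
  where
  𝓑-zero : ∀ k → 𝓑 (λ _ → 0ℚ) k ≡ 0ℚ
  𝓑-zero zero    = refl
  𝓑-zero (suc k) = cong₂ _+_ (𝓑-zero k) (𝓑-zero k)

-- Multiple harmonic-like numbers

-- The bound is an indicator, so n can shrink while the box of tuples stays fixed; `≤ᵇ` is what the
-- decision in `boundedTuples` computes to.
weight : ∀ {m} → ℕ → Vec ℕ m → ℚ
weight n k = if Vec.sum k ℕ.≤ᵇ n then recip (Vec.foldr′ ℕ._*_ 1 k) else 0ℚ

-- The left side is what `suc i ℕ.+ s ℕ.≤ᵇ n` computes to: a first entry `suc i` leaves `n ∸ suc i`
-- for the rest. For n ≤ i the subtraction would truncate and wrongly admit s = 0.
<ᵇ-∸ : ∀ i n s → i < n → (i ℕ.+ s ℕ.<ᵇ n) ≡ (s ℕ.≤ᵇ n ∸ suc i)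
<ᵇ-∸ zero    (suc n) zero    _         = refl
<ᵇ-∸ zero    (suc n) (suc s) _         = refl
<ᵇ-∸ (suc i) (suc n) s       (s≤s i<n) = <ᵇ-∸ i n s i<n

<ᵇ-false : ∀ i n s → n ≤ i → (i ℕ.+ s ℕ.<ᵇ n) ≡ false
<ᵇ-false i       zero    s _         = refl
<ᵇ-false (suc i) (suc n) s (s≤s n≤i) = <ᵇ-false i n s n≤i

weight-∷ : ∀ {m} i n (k : Vec ℕ m) → i < n → weight n (suc i Vec.∷ k) ≡ recip (suc i) * weight (n ∸ suc i) k
weight-∷ i n k i<n rewrite <ᵇ-∸ i n (Vec.sum k) i<n with Vec.sum k ℕ.≤ᵇ n ∸ suc i
... | true  = recip-* (suc i) (Vec.foldr′ ℕ._*_ 1 k)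
... | false = sym (*-zeroʳ (recip (suc i)))

weight-∷-vanish : ∀ {m} i n (k : Vec ℕ m) → n ≤ i → weight n (suc i Vec.∷ k) ≡ 0ℚ
weight-∷-vanish i n k n≤i rewrite <ᵇ-false i n (Vec.sum k) n≤i = refl

sumOver-tuples : ∀ m N (f : Vec ℕ (suc m) → ℚ) →
  sumOver (tuples (suc m) N) f ≡ sumTo N (λ i → sumOver (tuples m N) (λ k → f (suc i Vec.∷ k)))
sumOver-tuples m N f = trans
  (sumOver-cartesianProductWith Vec._∷_ [ 1 ⋯ N ] (tuples m N) f)
  (sumOver-applyUpTo suc (λ x → sumOver (tuples m N) (λ k → f (x Vec.∷ k))) N)

-- Splitting off the first entry gives H_n(m+1) as the sum of H_{n-k}(m)/k, a Cauchy product with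
-- -ln(1-z). The box size N is independent of n because the remaining entries still range over the
-- old box.
sumOver-weight : ∀ m n N → n ≤ N → sumOver (tuples m N) (weight n) ≡ 𝓑 (ln1+z ^ˢ m) n
sumOver-weight zero    n N n≤N = sym (𝓑-one n)
sumOver-weight (suc m) n N n≤N = begin
  sumOver (tuples (suc m) N) (weight n)                                       ≡⟨ sumOver-tuples m N (weight n) ⟩
  sumTo N (λ i → sumOver (tuples m N) (λ k → weight n (suc i Vec.∷ k)))       ≡⟨ sumTo-restrict n≤N inside outside ⟩
  sumTo n (λ i → recip (suc i) * 𝓑 (ln1+z ^ˢ m) (n ∸ suc i))                  ≡⟨ +-identityˡ _ ⟨
  -- The dummy `recip 0` equals the zero constant term of -ln(1-z), so the index i = 0 can be added.
  0ℚ + sumTo n (λ i → recip (suc i) * 𝓑 (ln1+z ^ˢ m) (n ∸ suc i))             ≡⟨ cong (_+ sumTo n (λ i → recip (suc i) * 𝓑 (ln1+z ^ˢ m) (n ∸ suc i))) (*-zeroˡ (𝓑 (ln1+z ^ˢ m) n)) ⟨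
  sumTo (suc n) (λ i → recip i * 𝓑 (ln1+z ^ˢ m) (n ∸ i))                      ≡⟨ ⊛-sumTo recip (𝓑 (ln1+z ^ˢ m)) n ⟨
  (recip ⊛ 𝓑 (ln1+z ^ˢ m)) n                                                  ≡⟨ ⊛-congʳ (𝓑 (ln1+z ^ˢ m)) 𝓣-ln n ⟨
  (𝓣 ln1+z ⊛ 𝓑 (ln1+z ^ˢ m)) n                                                ≡⟨ 𝓑-⊛ ln1+z (ln1+z ^ˢ m) n ⟨
  𝓑 (ln1+z ^ˢ suc m) n                                                        ∎
  where
  inside : ∀ i → i < n → sumOver (tuples m N) (λ k → weight n (suc i Vec.∷ k)) ≡ recip (suc i) * 𝓑 (ln1+z ^ˢ m) (n ∸ suc i)
  inside i i<n = begin
    sumOver (tuples m N) (λ k → weight n (suc i Vec.∷ k))                  ≡⟨ sumOver-cong (tuples m N) (λ k → weight-∷ i n k i<n) ⟩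
    sumOver (tuples m N) (λ k → recip (suc i) * weight (n ∸ suc i) k)      ≡⟨ sumOver-*ˡ (tuples m N) (recip (suc i)) (weight (n ∸ suc i)) ⟩
    recip (suc i) * sumOver (tuples m N) (weight (n ∸ suc i))              ≡⟨ cong (recip (suc i) *_) (sumOver-weight m (n ∸ suc i) N (ℕ.≤-trans (ℕ.m∸n≤m n (suc i)) n≤N)) ⟩
    recip (suc i) * 𝓑 (ln1+z ^ˢ m) (n ∸ suc i)                             ∎
  outside : ∀ i → n ≤ i → sumOver (tuples m N) (λ k → weight n (suc i Vec.∷ k)) ≡ 0ℚ
  outside i n≤i = sumOver-zero (tuples m N) (λ k → weight-∷-vanish i n k n≤i)

multiH≡𝓑 : ∀ n m → multiH n m ≡ 𝓑 (ln1+z ^ˢ m) n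
multiH≡𝓑 n zero    = sym (𝓑-one n)
multiH≡𝓑 n (suc m) = begin
  multiH n (suc m)                        ≡⟨ sumOver-filter _ (tuples (suc m) n) _ ⟩
  sumOver (tuples (suc m) n) _            ≡⟨ sumOver-tuples m n _ ⟩
  -- Entries are positive, so the condition 1 ≤ k₁ + ⋯ + k_m evaluates to true.
  sumTo n _                               ≡⟨ sumOver-tuples m n (weight n) ⟨
  sumOver (tuples (suc m) n) (weight n)   ≡⟨ sumOver-weight (suc m) n n ℕ.≤-refl ⟩
  𝓑 (ln1+z ^ˢ suc m) n                    ∎

-- The inner Stirling sum

stirling/! : ∀ j m → s j m * recip (j !) ≡ recip (m !) * (ln1+z ^ˢ m) j
stirling/! j m = begin
  fromℕ (j !) * x * recip (j !)     ≡⟨ solve 3 (λ a x b → a :* x :* b := a :* b :* x) refl (fromℕ (j !)) x (recip (j !)) ⟩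
  fromℕ (j !) * recip (j !) * x     ≡⟨ cong (_* x) (n*recip[n]≡1 (j !) {{ℕ._!≢0 j}}) ⟩
  1ℚ * x                            ≡⟨ *-identityˡ x ⟩
  x                                 ∎
  where x = recip (m !) * (ln1+z ^ˢ m) j

-- After the factorials cancel, the sum is the binomial transform of the shifted series ln(1+z)^m /
-- m!, and Pascal's rule makes this a difference of consecutive values.
stirling-sum : ∀ m i →
  (∑[ j ∈ [ m ⋯ suc i ] ] (fromℕ (binom i (j ⊖ 1)) * (s j m * recip (j !))))
    ≡ recip (m !) * (multiH (suc i) m - multiH i m)
stirling-sum m i = begin
  sumOver [ m ⋯ suc i ] term                          ≡⟨ sumOver-applyUpTo (m ℕ.+_) term (suc (suc i) ∸ m) ⟩
  sumTo (suc (suc i) ∸ m) (term ∘ (m ℕ.+_))           ≡⟨ sumTo-drop m (suc (suc i)) term vanish ⟩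
  -- `0 ⊖ 1` is negative, so its binomial is 0. This matters for m = 0, where j = 0 lies in the
  -- range and s(0,0) = 1.
  term 0 + sumTo (suc i) (term ∘ suc)                 ≡⟨ cong (_+ sumTo (suc i) (term ∘ suc)) (*-zeroˡ (s 0 m * recip (0 !))) ⟩
  0ℚ + sumTo (suc i) (term ∘ suc)                     ≡⟨ +-identityˡ _ ⟩
  sumTo (suc i) (term ∘ suc)                          ≡⟨ sumTo-cong (suc i) factor ⟩
  sumTo (suc i) (λ j → c * (fromℕ (i C j) * F (suc j))) ≡⟨ sumTo-*ˡ (suc i) c (λ j → fromℕ (i C j) * F (suc j)) ⟩
  c * sumTo (suc i) (λ j → fromℕ (i C j) * F (suc j)) ≡⟨ cong (c *_) (sumTo-binomial i (suc i) (F ∘ suc) ℕ.≤-refl) ⟩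
  -- By definition `𝓑 F (suc i)` is `𝓑 F i + 𝓑 (F ∘ suc) i`.
  c * 𝓑 (F ∘ suc) i                                   ≡⟨ cong (c *_) (solve 2 (λ x y → y := (x :+ y) :- x) refl (𝓑 F i) (𝓑 (F ∘ suc) i)) ⟩
  c * (𝓑 F (suc i) - 𝓑 F i)                           ≡⟨ cong₂ (λ x y → c * (x - y)) (multiH≡𝓑 (suc i) m) (multiH≡𝓑 i m) ⟨
  c * (multiH (suc i) m - multiH i m)                 ∎
  where
  F = ln1+z ^ˢ m
  c = recip (m !)
  term : ℕ → ℚ
  term j = fromℕ (binom i (j ⊖ 1)) * (s j m * recip (j !))
  vanish : ∀ j → j < m → term j ≡ 0ℚ
  vanish j j<m = begin
    b * (s j m * recip (j !))   ≡⟨ cong (b *_) (stirling/! j m) ⟩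
    b * (c * F j)               ≡⟨ cong (λ x → b * (c * x)) (ln^-vanish m j j<m) ⟩
    b * (c * 0ℚ)                ≡⟨ cong (b *_) (*-zeroʳ c) ⟩
    b * 0ℚ                      ≡⟨ *-zeroʳ b ⟩
    0ℚ                          ∎
    where b = fromℕ (binom i (j ⊖ 1))
  factor : ∀ j → term (suc j) ≡ c * (fromℕ (i C j) * F (suc j))
  factor j = trans (cong (fromℕ (i C j) *_) (stirling/! (suc j) m))
    (solve 3 (λ b c x → b :* (c :* x) := c :* (b :* x)) refl (fromℕ (i C j)) c (F (suc j)))

-- Summation by parts against the harmonic numbers

H-suc : ∀ n → H (suc n) ≡ H n + recip (suc n)
H-suc n = begin
  H (suc n)                              ≡⟨ sumOver-applyUpTo suc recip (suc n) ⟩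
  sumTo (suc n) (recip ∘ suc)            ≡⟨ sumTo-last n (recip ∘ suc) ⟩
  sumTo n (recip ∘ suc) + recip (suc n)  ≡⟨ cong (_+ recip (suc n)) (sumOver-applyUpTo suc recip n) ⟨
  H n + recip (suc n)                    ∎

-- The product h_k H_k grows by H_k (h_k - h_{k-1}) + h_{k-1}/k at each step, and its initial value
-- vanishes because H_0 = 0, whatever h_0 is.
summation-by-parts : ∀ c (h : ℕ → ℚ) n →
  sumTo n (λ i → H (suc i) * (c * (h (suc i) - h i))) ≡ c * h n * H n - c * sumTo n (λ i → h i * recip (suc i))
summation-by-parts c h zero    = sym (cong₂ _-_ (*-zeroʳ (c * h 0)) (*-zeroʳ c))
summation-by-parts c h (suc n) = begin
  sumTo (suc n) f                                              ≡⟨ sumTo-last n f ⟩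
  sumTo n f + H (suc n) * (c * (h (suc n) - h n))              ≡⟨ cong₂ (λ x y → x + y * (c * (h (suc n) - h n))) (summation-by-parts c h n) (H-suc n) ⟩
  (c * h n * H n - c * S) + (H n + r) * (c * (h (suc n) - h n))
    ≡⟨ solve 6 (λ c h h′ H S r → (c :* h :* H :- c :* S) :+ (H :+ r) :* (c :* (h′ :- h))
                               := c :* h′ :* (H :+ r) :- c :* (S :+ h :* r)) refl c (h n) (h (suc n)) (H n) S r ⟩
  c * h (suc n) * (H n + r) - c * (S + h n * r)                ≡⟨ cong₂ (λ x y → c * h (suc n) * x - c * y) (H-suc n) (sumTo-last n g) ⟨
  c * h (suc n) * H (suc n) - c * sumTo (suc n) g              ∎
  where
  f g : ℕ → ℚ
  f i = H (suc i) * (c * (h (suc i) - h i))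
  g i = h i * recip (suc i)
  S = sumTo n g
  r = recip (suc n)

theorem6 : (m n : ℕ) →
    (∑[ k ∈ [ 1 ⋯ n ] ] (H k * (∑[ j ∈ [ m ⋯ k ] ] (fromℕ (binom (k ∸ 1) (j ⊖ 1)) * (s j m * recip (j !))))))
    ≡ (recip (m !) * multiH n m * H n) - (recip (m !) * (∑[ k ∈ [ 1 ⋯ n ] ] (multiH (k ∸ 1) m * recip k)))
theorem6 m n = begin
  _                                                                            ≡⟨ sumOver-applyUpTo suc _ n ⟩
  -- With k = `suc i`, the upper index `k ∸ 1` computes to `i`, the form treated by `stirling-sum`.
  _                                                                            ≡⟨ sumTo-cong n (λ i → cong (H (suc i) *_) (stirling-sum m i)) ⟩
  sumTo n (λ i → H (suc i) * (c * (multiH (suc i) m - multiH i m)))            ≡⟨ summation-by-parts c (λ k → multiH k m) n ⟩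
  c * multiH n m * H n - c * sumTo n (λ i → multiH i m * recip (suc i))        ≡⟨ cong (λ x → c * multiH n m * H n - c * x) (sumOver-applyUpTo suc (λ k → multiH (k ∸ 1) m * recip k) n) ⟨
  c * multiH n m * H n - c * (∑[ k ∈ [ 1 ⋯ n ] ] (multiH (k ∸ 1) m * recip k)) ∎
  where c = recip (m !)
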